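{- There is a cubical graph of girth $8$ that is not layered.
   Context: The hypercube $Q_n$ is the graph with vertex set $\{A : A\subseteq [n]\}$ and edge set all pairs $\{A,B\}$ with $A\subseteq B$ and $|A|=|B|-1$. A graph is cubical if it is (isomorphic to) a subgraph of $Q_n$ for some $n$. The $k$th edge layer of $Q_n$ is the subgraph of $Q_n$ induced by $\binom{[n]}{k}\cup\binom{[n]}{k-1}$. A graph is layered if it is (isomorphic to) a subgraph of some edge layer of $Q_n$ for some $n$. The girth of a graph is the length of its shortest cycle. -}

module Defs where

open import Data.Fin.Base using (Fin; toℕ)
open import Data.Fin.Subset using (Subset; _⊆_; ∣_∣)
open import Data.Nat.Base using (ℕ; suc; _≤_)
open import Data.Nat.DivMod using (_mod_)
open import Data.Nat.Properties using (1+n≢n)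
open import Data.Product.Base using (Σ; ∃; _×_; _,_)
open import Data.Refinement.Base using (Refinement; Refinement-syntax; value)
open import Data.Sum.Base using (_⊎_; inj₁; inj₂; swap)
open import Function.Bundles using (_↔_; _⇔_; module Inverse)
open import Function.Definitions using (Injective)
open import Level using (0ℓ)
open import Relation.Binary.Core using (Rel)
open import Relation.Binary.Definitions using (Symmetric; Irreflexive)
open import Relation.Binary.PropositionalEquality.Core using (_≡_; refl; sym)
open import Relation.Unary using (Pred)

-- Finiteness is not a field: a graph isomorphic to a subgraph of a
-- hypercube is finite anyway.
record Graph : Set₁ where
  field
    Vertex     : Set
    Adj        : Rel Vertex 0ℓ
    adj-sym    : Symmetric Adj
    adj-irrefl : Irreflexive _≡_ Adj

open Graph public

record Subgraph (H : Graph) : Set₁ where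
  field
    vertices  : Pred (Vertex H) 0ℓ
    edges     : Rel (Vertex H) 0ℓ
    edges-sym : Symmetric edges
    edges⊆Adj : ∀ {x y} → edges x y → Adj H x y
    endpoint  : ∀ {x y} → edges x y → vertices x

open Subgraph public

-- The membership proof in a refinement type is irrelevant, so two vertices
-- are equal as soon as they are equal in H.
⟦_⟧ : {H : Graph} → Subgraph H → Graph
⟦_⟧ {H} S = record
  { Vertex     = [ x ∈ Vertex H ∣ vertices S x ]
  ; Adj        = λ x y → edges S (value x) (value y)
  ; adj-sym    = edges-sym S
  ; adj-irrefl = λ { refl e → adj-irrefl H refl (edges⊆Adj S e) }
  }

induced : (H : Graph) → Pred (Vertex H) 0ℓ → Subgraph H
induced H P = record
  { vertices  = P
  ; edges     = λ x y → P x × P y × Adj H x y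
  ; edges-sym = λ { (px , py , e) → py , px , adj-sym H e }
  ; edges⊆Adj = λ { (_ , _ , e) → e }
  ; endpoint  = λ { (px , _ , _) → px }
  }

infix 4 _≅_

record _≅_ (G H : Graph) : Set where
  field
    bijection : Vertex G ↔ Vertex H

  open Inverse bijection using (to)

  field
    adj⇔ : ∀ x y → Adj G x y ⇔ Adj H (to x) (to y)

IsoToSubgraphOf : Graph → Graph → Set₁
IsoToSubgraphOf G H = Σ (Subgraph H) λ S → G ≅ ⟦ S ⟧

infix 4 _⋖_

_⋖_ : ∀ {n} → Rel (Subset n) 0ℓ
A ⋖ B = A ⊆ B × ∣ B ∣ ≡ suc ∣ A ∣

-- Edges are unordered pairs, hence the symmetrisation of _⋖_.
Q : ℕ → Graph
Q n = record
  { Vertex     = Subset n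
  ; Adj        = λ A B → A ⋖ B ⊎ B ⋖ A
  ; adj-sym    = swap
  ; adj-irrefl = λ { refl (inj₁ (_ , eq)) → 1+n≢n (sym eq)
                   ; refl (inj₂ (_ , eq)) → 1+n≢n (sym eq) }
  }

-- suc ∣ A ∣ ≡ k says ∣ A ∣ = k − 1 without truncated subtraction.
edgeLayer : ℕ → ℕ → Graph
edgeLayer n k = ⟦ induced (Q n) (λ A → ∣ A ∣ ≡ k ⊎ suc ∣ A ∣ ≡ k) ⟧

Cubical : Graph → Set₁
Cubical G = ∃ λ n → IsoToSubgraphOf G (Q n)

Layered : Graph → Set₁
Layered G = ∃ λ n → ∃ λ k → IsoToSubgraphOf G (edgeLayer n k)

cyclicSuc : ∀ {n} → Fin n → Fin n
cyclicSuc {suc n} i = suc (toℕ i) mod suc n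

record Cycle (G : Graph) (ℓ : ℕ) : Set where
  field
    3≤length : 3 ≤ ℓ
    vertex   : Fin ℓ → Vertex G
    distinct : Injective _≡_ _≡_ vertex
    adjacent : ∀ i → Adj G (vertex i) (vertex (cyclicSuc i))

HasGirth : Graph → ℕ → Set
HasGirth G g = Cycle G g × (∀ {ℓ} → Cycle G ℓ → g ≤ ℓ)

{-# OPTIONS --safe #-}
module Submission where

-- Why such a graph exists.  A theta consists of three paths of length 4 that
-- share their ends S and T and are otherwise disjoint.  An embedding in an
-- edge layer of a hypercube colours each edge with the element that it adds
-- or removes, and along any path additions and removals alternate.  Say that
-- the paths from S start with an addition; the other case is dual.  If the
-- first and the last colour of some path of a theta differ, then the elements
-- added on its first and third edge are in T but not in S.  Each of the other
-- two paths must add both of them as well, and must not start as the first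
-- path does, so both start with the same element, which is absurd.  Hence on
-- each path of a theta in a layer the first and the last colour agree
-- (theta-ends).
--
-- Take a spine v₀ v₁ … v₆, and for i = 0, 1, 2 complete its segment from vᵢ
-- to vᵢ₊₄ to a theta.  In a layer the spine is then coloured a b c a b c, so
-- each of a, b, c is added once and removed once, and v₀ = v₆
-- (period-3-closes); hence the graph is not layered.  In Q₆, however, the spine can be the chain
-- ∅, {0}, {0,1}, …, {0,…,5}, and the two further paths of each theta can be
-- chosen, as maximal chains of the interval from vᵢ to vᵢ₊₄, such that no
-- cycle shorter than 8 arises.  This is checked by following all walks
-- without backtracking.

open import Defs
open import Data.Empty using (⊥)
open import Data.Fin.Base using (Fin; zero; suc; toℕ; inject₁; fromℕ<)
open import Data.Fin.Patterns using (0F; 1F; 2F; 3F; 4F; 5F; 6F; 7F)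
open import Data.Fin.Properties as Fin using (all?; toℕ-fromℕ<)
open import Data.Fin.Subset using (Subset; Side; inside; outside; _⊆_; ∣_∣)
open import Data.Fin.Subset.Properties using (drop-∷-⊆; p⊆q⇒∣p∣≤∣q∣; _⊆?_)
open import Data.List.Base using (List; map; _++_; deduplicate; allFin; cartesianProduct)
open import Data.List.Membership.Propositional using (_∈_)
open import Data.List.Membership.Propositional.Properties
  using (∈-map⁺; ∈-++⁺ˡ; ∈-++⁺ʳ; ∈-cartesianProduct⁺; ∈-allFin; ∈-deduplicate⁺)
open import Data.List.Relation.Unary.All as All using (All)
open import Data.Bool.Properties using () renaming (_≟_ to _≟ᴮ_)
open import Data.Irrelevant using ([_])
open import Data.Nat.Base using (ℕ; zero; suc; _+_; _≤_; _<_; z≤n; s≤s)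
open import Data.Nat.Properties as ℕ
  using (suc-injective; 1+n≢n; ≮⇒≥; +-suc; +-identityʳ; m≢1+n+m)
open import Data.Product using (∃; _×_; _,_; proj₁; proj₂; swap)
open import Data.Product.Properties using () renaming (≡-dec to ×-≡-dec)
open import Data.Refinement.Base using (Refinement; value; _,_)
open import Data.Sum.Base using (_⊎_; inj₁; inj₂; [_,_]′)
open import Data.Unit.Base using (⊤; tt)
open import Data.Vec.Base using (Vec; []; _∷_; lookup; here)
open import Data.Vec.Properties using (≡-dec)
open import Data.Vec.Relation.Binary.Pointwise.Extensional using (ext; Pointwise-≡⇒≡)
open import Function.Base using (_∘_)
open import Function.Bundles using (module Inverse; module Equivalence; module Injection)
open import Function.Construct.Identity using (↔-id; ⇔-id)
open import Function.Properties.Inverse using (↔⇒↣)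
open import Relation.Binary.Definitions using (DecidableEquality)
open import Relation.Binary.PropositionalEquality
  using (_≡_; _≢_; refl; sym; trans; cong; subst; ≢-sym)
open import Relation.Nullary using (¬_; Dec; yes; no; contradiction; ¬?)
open import Relation.Nullary.Decidable using (from-yes; _×-dec_; _→-dec_)

-- Walks that toggle one element at a time

-- B arises from A by changing the side of the element i, and of no other
-- element, from d to e.
record Toggle {n : ℕ} (d e : Side) (i : Fin n) (A B : Subset n) : Set where
  field
    before : lookup A i ≡ d
    after  : lookup B i ≡ e
    off    : ∀ {j} → j ≢ i → lookup A j ≡ lookup B j

open Toggle

Toggle-flip : ∀ {n d e i} {A B : Subset n} → Toggle d e i A B → Toggle e d i B A
Toggle-flip t = record { before = after t ; after = before t ; off = sym ∘ off t }

Toggle-∷ : ∀ {n s d e i} {A B : Subset n} →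
           Toggle d e i A B → Toggle d e (suc i) (s ∷ A) (s ∷ B)
Toggle-∷ t = record
  { before = before t
  ; after  = after t
  ; off    = λ { {zero} _ → refl ; {suc j} j≢i → off t (j≢i ∘ cong suc) }
  }

⊆∧∣∣≡⇒≡ : ∀ {n} {A B : Subset n} → A ⊆ B → ∣ B ∣ ≡ ∣ A ∣ → A ≡ B
⊆∧∣∣≡⇒≡ {A = []} {[]} A⊆B eq = refl
⊆∧∣∣≡⇒≡ {A = outside ∷ A} {outside ∷ B} A⊆B eq =
  cong (outside ∷_) (⊆∧∣∣≡⇒≡ (drop-∷-⊆ A⊆B) eq)
⊆∧∣∣≡⇒≡ {A = outside ∷ A} {inside ∷ B} A⊆B eq =
  contradiction (subst (_≤ ∣ B ∣) (sym eq) (p⊆q⇒∣p∣≤∣q∣ (drop-∷-⊆ A⊆B))) ℕ.1+n≰n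
⊆∧∣∣≡⇒≡ {A = inside ∷ A} {outside ∷ B} A⊆B eq with () ← A⊆B here
⊆∧∣∣≡⇒≡ {A = inside ∷ A} {inside ∷ B} A⊆B eq =
  cong (inside ∷_) (⊆∧∣∣≡⇒≡ (drop-∷-⊆ A⊆B) (suc-injective eq))

⋖⇒Toggle : ∀ {n} {A B : Subset n} → A ⋖ B → ∃ λ i → Toggle outside inside i A B
⋖⇒Toggle {A = []} {[]} (_ , ())
⋖⇒Toggle {A = outside ∷ A} {outside ∷ B} (A⊆B , eq) =
  let i , t = ⋖⇒Toggle (drop-∷-⊆ A⊆B , eq) in suc i , Toggle-∷ t
⋖⇒Toggle {A = outside ∷ A} {inside ∷ B} (A⊆B , eq)
  with refl ← ⊆∧∣∣≡⇒≡ (drop-∷-⊆ A⊆B) (suc-injective eq) = zero , record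
  { before = refl
  ; after  = refl
  ; off    = λ { {zero} 0≢0 → contradiction refl 0≢0 ; {suc j} _ → refl }
  }
⋖⇒Toggle {A = inside ∷ A} {outside ∷ B} (A⊆B , eq) with () ← A⊆B here
⋖⇒Toggle {A = inside ∷ A} {inside ∷ B} (A⊆B , eq) =
  let i , t = ⋖⇒Toggle (drop-∷-⊆ A⊆B , suc-injective eq) in suc i , Toggle-∷ t

module _ {n : ℕ} {d e : Side} (d≢e : d ≢ e) where

  distinct-colours : ∀ {i j} {A B C : Subset n} →
    Toggle d e i A B → Toggle e d j B C → A ≢ C → i ≢ j
  distinct-colours {i} t u A≢C refl = A≢C (Pointwise-≡⇒≡ (ext agree))
    where
    agree : ∀ k → _
    agree k with k Fin.≟ i
    ... | yes refl = trans (before t) (sym (after u))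
    ... | no  k≢i  = trans (off t k≢i) (off u k≢i)

  keep-target : ∀ {i k} {A B : Subset n} →
    Toggle d e i A B → lookup A k ≡ e → lookup B k ≡ e
  keep-target {i} {k} t Ak≡e with k Fin.≟ i
  ... | yes refl = after t
  ... | no  k≢i  = trans (sym (off t k≢i)) Ak≡e

  -- Two toggles of the same kind cannot share an element if that element is
  -- not toggled back in between.
  distinct-colours₂ : ∀ {i j k} {A B C D : Subset n} → i ≢ j →
    Toggle d e i A B → Toggle e d j B C → Toggle d e k C D → i ≢ k
  distinct-colours₂ i≢j t u w refl =
    d≢e (trans (sym (before w)) (trans (sym (off u i≢j)) (after t)))

-- A walk of length 4 from S to T with alternating directions; d is outside
-- if the walk starts with an addition and inside if with a removal.
record Trail {n : ℕ} (d e : Side) (S A B C T : Subset n) : Set where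
  field
    {c₁ c₂ c₃ c₄} : Fin n
    t₁ : Toggle d e c₁ S A
    t₂ : Toggle e d c₂ A B
    t₃ : Toggle d e c₃ B C
    t₄ : Toggle e d c₄ C T

open Trail

module _ {n : ℕ} {d e : Side} (d≢e : d ≢ e) {S T : Subset n} where

  -- The second and fourth step of a trail change sides from e to d, so an
  -- element that ends up changed from d to e is its first or third colour.
  moved : ∀ {A B C i} (P : Trail d e S A B C T) →
          lookup S i ≡ d → lookup T i ≡ e → i ≡ c₁ P ⊎ i ≡ c₃ P
  moved {i = i} P Si≡d Ti≡e with i Fin.≟ c₁ P | i Fin.≟ c₃ P
  ... | yes i≡c₁ | _        = inj₁ i≡c₁
  ... | no _     | yes i≡c₃ = inj₂ i≡c₃
  ... | no i≢c₁  | no i≢c₃  = contradiction (trans (sym Ti≡d) Ti≡e) d≢e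
    where
    Bi≡d = keep-target (≢-sym d≢e) (t₂ P) (trans (sym (off (t₁ P) i≢c₁)) Si≡d)
    Ti≡d = keep-target (≢-sym d≢e) (t₄ P) (trans (sym (off (t₃ P) i≢c₃)) Bi≡d)

  same-colour⇒≡ : ∀ {i j} {A A′ : Subset n} →
    Toggle d e i S A → Toggle d e j S A′ → i ≡ j → A ≡ A′
  same-colour⇒≡ {i} t u refl = Pointwise-≡⇒≡ (ext agree)
    where
    agree : ∀ k → _
    agree k with k Fin.≟ i
    ... | yes refl = trans (after t) (sym (after u))
    ... | no  k≢i  = trans (sym (off t k≢i)) (off u k≢i)

  -- On a path of a theta the first and the last colour agree.  The
  -- inequalities S ≢ B, A ≢ C, B ≢ T say that the first path does
  -- not backtrack.
  theta-ends : ∀ {A B C A′ B′ C′ A″ B″ C″} →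
    (P : Trail d e S A B C T) → S ≢ B → A ≢ C → B ≢ T →
    Trail d e S A′ B′ C′ T → Trail d e S A″ B″ C″ T →
    A ≢ A′ → A ≢ A″ → A′ ≢ A″ → c₁ P ≡ c₄ P
  theta-ends {A} P S≢B A≢C B≢T P′ P″ A≢A′ A≢A″ A′≢A″ with c₁ P Fin.≟ c₄ P
  ... | yes c₁≡c₄ = c₁≡c₄
  ... | no  c₁≢c₄ = contradiction
      (same-colour⇒≡ (t₁ P′) (t₁ P″) (trans (sym (starts-with-c₃ P′ A≢A′)) (starts-with-c₃ P″ A≢A″)))
      A′≢A″
    where
    c₁≢c₂ = distinct-colours d≢e (t₁ P) (t₂ P) S≢B
    c₂≢c₃ = distinct-colours (≢-sym d≢e) (t₂ P) (t₃ P) A≢C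
    c₃≢c₄ = distinct-colours d≢e (t₃ P) (t₄ P) B≢T
    c₁≢c₃ = distinct-colours₂ d≢e c₁≢c₂ (t₁ P) (t₂ P) (t₃ P)

    c₁-ends-at-e : lookup T (c₁ P) ≡ e
    c₁-ends-at-e = trans (sym (off (t₄ P) c₁≢c₄))
      (keep-target d≢e (t₃ P) (trans (sym (off (t₂ P) c₁≢c₂)) (after (t₁ P))))

    c₃-starts-at-d : lookup S (c₃ P) ≡ d
    c₃-starts-at-d = trans (off (t₁ P) (≢-sym c₁≢c₃))
      (trans (off (t₂ P) (≢-sym c₂≢c₃)) (before (t₃ P)))

    c₃-ends-at-e : lookup T (c₃ P) ≡ e
    c₃-ends-at-e = trans (sym (off (t₄ P) c₃≢c₄)) (after (t₃ P))

    -- R uses c₁ P and c₃ P as its first and third colour, in some order, and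
    -- does not start with c₁ P.
    starts-with-c₃ : ∀ {X Y Z} (R : Trail d e S X Y Z T) → A ≢ X → c₃ P ≡ c₁ R
    starts-with-c₃ R A≢X with moved R (before (t₁ P)) c₁-ends-at-e
                            | moved R c₃-starts-at-d c₃-ends-at-e
    ... | inj₁ c₁≡ | _        = contradiction (same-colour⇒≡ (t₁ P) (t₁ R) c₁≡) A≢X
    ... | inj₂ _   | inj₁ c₃≡ = c₃≡
    ... | inj₂ c₁≡ | inj₂ c₃≡ = contradiction (trans c₁≡ (sym c₃≡)) c₁≢c₃

-- Elements a, b, c are toggled, each once in either direction.
period-3-closes : ∀ {n} {d e : Side} {a b c : Fin n} {A₀ A₁ A₂ A₃ A₄ A₅ A₆} →
  a ≢ b → b ≢ c → a ≢ c →
  Toggle d e a A₀ A₁ → Toggle e d b A₁ A₂ → Toggle d e c A₂ A₃ →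
  Toggle e d a A₃ A₄ → Toggle d e b A₄ A₅ → Toggle e d c A₅ A₆ →
  A₀ ≡ A₆
period-3-closes {a = a} {b} {c} {A₀} {A₆ = A₆} a≢b b≢c a≢c t₁ t₂ t₃ t₄ t₅ t₆ =
  Pointwise-≡⇒≡ (ext agree)
  where
  agree : ∀ k → lookup A₀ k ≡ lookup A₆ k
  agree k with k Fin.≟ a | k Fin.≟ b | k Fin.≟ c
  ... | yes refl | _ | _ = trans (before t₁)
    (trans (sym (after t₄)) (trans (off t₅ a≢b) (off t₆ a≢c)))
  ... | no k≢a | yes refl | _ = trans (off t₁ k≢a)
    (trans (before t₂) (trans (sym (after t₅)) (off t₆ b≢c)))
  ... | no k≢a | no k≢b | yes refl = trans (off t₁ k≢a)
    (trans (off t₂ k≢b) (trans (before t₃) (sym (after t₆))))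
  ... | no k≢a | no k≢b | no k≢c = trans (off t₁ k≢a) (trans (off t₂ k≢b)
    (trans (off t₃ k≢c) (trans (off t₄ k≢a) (trans (off t₅ k≢b) (off t₆ k≢c)))))

-- Edge layers

-- In the k-th edge layer, Level k outside is the lower level, from which
-- every edge adds an element, and Level k inside is the upper one.
Level : ∀ {n} → ℕ → Side → Subset n → Set
Level k inside  A = ∣ A ∣ ≡ k
Level k outside A = suc ∣ A ∣ ≡ k

InLayer : ∀ {n} → ℕ → Subset n → Set
InLayer k A = Level k inside A ⊎ Level k outside A

layer-edge : ∀ {n k d e} {A B : Subset n} → d ≢ e →
  Level k d A → InLayer k B → A ⋖ B ⊎ B ⋖ A →
  Level k e B × ∃ λ i → Toggle d e i A B
layer-edge {d = inside}  {inside}  d≢e _ _ _ = contradiction refl d≢e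
layer-edge {d = outside} {outside} d≢e _ _ _ = contradiction refl d≢e
layer-edge {d = outside} {inside} _ refl _ (inj₁ A⋖B@(_ , ∣B∣≡)) = ∣B∣≡ , ⋖⇒Toggle A⋖B
layer-edge {d = outside} {inside} {A} {B} _ refl B∈ (inj₂ (_ , ∣A∣≡)) with B∈
... | inj₁ ∣B∣≡ = contradiction (trans ∣B∣≡ (cong suc ∣A∣≡)) (m≢1+n+m ∣ B ∣ {1})
... | inj₂ ∣B∣≡ = contradiction (trans ∣A∣≡ ∣B∣≡) (≢-sym 1+n≢n)
layer-edge {d = inside} {outside} _ refl _ (inj₂ B⋖A@(_ , ∣A∣≡)) =
  let i , t = ⋖⇒Toggle B⋖A in sym ∣A∣≡ , i , Toggle-flip t
layer-edge {d = inside} {outside} {A} {B} _ refl B∈ (inj₁ (_ , ∣B∣≡)) with B∈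
... | inj₁ ∣B∣≡′ = contradiction (trans (sym ∣B∣≡) ∣B∣≡′) 1+n≢n
... | inj₂ ∣B∣≡′ = contradiction (sym (trans (sym (cong suc ∣B∣≡)) ∣B∣≡′)) (m≢1+n+m ∣ A ∣ {1})

-- The graph

-- Three chains from the empty to the full subset of a 4-element set, adding
-- the elements in the orders 0123, 1320 and 2301.  No two of them meet in
-- between.  The last two orders are chosen such that this is still so when the
-- chains are placed in the three windows below: paths from different windows
-- meet only on the spine.
chain : Fin 3 → Fin 5 → Subset 4
chain r j = lookup (lookup chains r) j
  where
  pattern o = outside
  pattern i = inside

  chains : Vec (Vec (Subset 4) 5) 3
  chains =
    ( (o ∷ o ∷ o ∷ o ∷ []) ∷ (i ∷ o ∷ o ∷ o ∷ []) ∷ (i ∷ i ∷ o ∷ o ∷ [])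
    ∷ (i ∷ i ∷ i ∷ o ∷ []) ∷ (i ∷ i ∷ i ∷ i ∷ []) ∷ [] ) ∷
    ( (o ∷ o ∷ o ∷ o ∷ []) ∷ (o ∷ i ∷ o ∷ o ∷ []) ∷ (o ∷ i ∷ o ∷ i ∷ [])
    ∷ (o ∷ i ∷ i ∷ i ∷ []) ∷ (i ∷ i ∷ i ∷ i ∷ []) ∷ [] ) ∷
    ( (o ∷ o ∷ o ∷ o ∷ []) ∷ (o ∷ o ∷ i ∷ o ∷ []) ∷ (o ∷ o ∷ i ∷ i ∷ [])
    ∷ (i ∷ o ∷ i ∷ i ∷ []) ∷ (i ∷ i ∷ i ∷ i ∷ []) ∷ [] ) ∷ []

-- The interval of Q₆ from {0,…,i−1} to {0,…,i+3}, as a copy of Q₄.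
window : Fin 3 → Subset 4 → Subset 6
window 0F (a ∷ b ∷ c ∷ d ∷ []) = a ∷ b ∷ c ∷ d ∷ outside ∷ outside ∷ []
window 1F (a ∷ b ∷ c ∷ d ∷ []) = inside ∷ a ∷ b ∷ c ∷ d ∷ outside ∷ []
window 2F (a ∷ b ∷ c ∷ d ∷ []) = inside ∷ inside ∷ a ∷ b ∷ c ∷ d ∷ []

window-injective : ∀ i {A B} → window i A ≡ window i B → A ≡ B
window-injective 0F {_ ∷ _ ∷ _ ∷ _ ∷ []} {_ ∷ _ ∷ _ ∷ _ ∷ []} refl = refl
window-injective 1F {_ ∷ _ ∷ _ ∷ _ ∷ []} {_ ∷ _ ∷ _ ∷ _ ∷ []} refl = refl
window-injective 2F {_ ∷ _ ∷ _ ∷ _ ∷ []} {_ ∷ _ ∷ _ ∷ _ ∷ []} refl = refl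

-- Vertex j of path r of theta i.  The paths with r = 0 overlap: their union
-- is the spine ∅, {0}, …, {0,…,5}.
point : Fin 3 → Fin 3 → Fin 5 → Subset 6
point i r j = window i (chain r j)

-- Indices (i , r , j) of edges: edge j of path r of theta i.
Index : Set
Index = Fin 3 × Fin 3 × Fin 4

source target : Index → Subset 6
source (i , r , j) = point i r (inject₁ j)
target (i , r , j) = point i r (suc j)

-- The edges of the three thetas, in both directions; not every edge of Q₆
-- between two points belongs to it.
thetas : Subgraph (Q 6)
thetas = record
  { vertices  = λ A → ∃ λ i → ∃ λ r → ∃ λ j → A ≡ point i r j
  ; edges     = λ A B → ∃ λ x → (A , B) ≡ (source x , target x) ⊎ (B , A) ≡ (source x , target x)
  ; edges-sym = λ { (x , inj₁ eq) → x , inj₂ eq ; (x , inj₂ eq) → x , inj₁ eq }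
  ; edges⊆Adj = λ { ((i , r , j) , inj₁ refl) → inj₁ (source⋖target i r j)
                  ; ((i , r , j) , inj₂ refl) → inj₂ (source⋖target i r j) }
  ; endpoint  = λ { ((i , r , j) , inj₁ refl) → i , r , inject₁ j , refl
                  ; ((i , r , j) , inj₂ refl) → i , r , suc j , refl }
  }
  where
  source⋖target : ∀ i r j → source (i , r , j) ⋖ target (i , r , j)
  source⋖target = from-yes (all? λ i → all? λ r → all? λ j →
    (source (i , r , j) ⊆? target (i , r , j)) ×-dec
    (∣ target (i , r , j) ∣ ℕ.≟ suc ∣ source (i , r , j) ∣))

-- A graph with 25 vertices and 30 edges.
G : Graph
G = ⟦ thetas ⟧

G-cubical : Cubical G
G-cubical = 6 , thetas , record { bijection = ↔-id _ ; adj⇔ = λ _ _ → ⇔-id _ }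

v : Fin 3 → Fin 3 → Fin 5 → Vertex G
v i r j = point i r j , [ (i , r , j , refl) ]

value-injective : ∀ {x y : Vertex G} → value x ≡ value y → x ≡ y
value-injective {_ , _} {_ , _} refl = refl

-- G is not layered

module _ {n k : ℕ} {S : Subgraph (edgeLayer n k)} (iso : G ≅ ⟦ S ⟧) where
  open _≅_ iso
  open Inverse bijection using (to)

  private
    -- The embedding in the edge layer, on underlying sets.
    φ : Vertex G → Subset n
    φ x = value (value (to x))

    φ-separates : ∀ {x y} → value x ≢ value y → φ x ≢ φ y
    φ-separates x≢y φx≡φy = x≢y (cong value (Injection.injective (↔⇒↣ bijection)
      (refinement-≡ (refinement-≡ φx≡φy))))
      where
      refinement-≡ : ∀ {A : Set} {P : A → Set} {a b : Refinement A P} → value a ≡ value b → a ≡ b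
      refinement-≡ {a = _ , _} {b = _ , _} refl = refl

    φ-edge : ∀ {d e} → d ≢ e → ∀ i r j → Level k d (φ (v i r (inject₁ j))) →
      Level k e (φ (v i r (suc j))) ×
      ∃ λ c → Toggle d e c (φ (v i r (inject₁ j))) (φ (v i r (suc j)))
    φ-edge d≢e i r j level
      with _ , B∈ , A~B ← edges⊆Adj S (Equivalence.to
             (adj⇔ (v i r (inject₁ j)) (v i r (suc j))) ((i , r , j) , inj₁ refl))
      = layer-edge d≢e level B∈ A~B

    φ-trail : ∀ {d e} → d ≢ e → ∀ i r → Level k d (φ (v i r 0F)) →
      Trail d e (φ (v i r 0F)) (φ (v i r 1F)) (φ (v i r 2F)) (φ (v i r 3F)) (φ (v i r 4F))
    φ-trail d≢e i r l₀ =
      let l₁ , _ , t₁ = φ-edge d≢e i r 0F l₀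
          l₂ , _ , t₂ = φ-edge (≢-sym d≢e) i r 1F l₁
          l₃ , _ , t₃ = φ-edge d≢e i r 2F l₂
          _  , _ , t₄ = φ-edge (≢-sym d≢e) i r 3F l₃
      in record { t₁ = t₁ ; t₂ = t₂ ; t₃ = t₃ ; t₄ = t₄ }

    apart : ∀ i {r j r′ j′} → chain r j ≢ chain r′ j′ → φ (v i r j) ≢ φ (v i r′ j′)
    apart i c≢c′ = φ-separates (c≢c′ ∘ window-injective i)

    -- P is an argument so that the trails on overlapping segments of the spine
    -- can share their colours.
    spine-ends : ∀ {d e} → d ≢ e → ∀ i → Level k d (φ (v i 0F 0F)) →
      (P : Trail d e (φ (v i 0F 0F)) (φ (v i 0F 1F)) (φ (v i 0F 2F)) (φ (v i 0F 3F)) (φ (v i 0F 4F))) →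
      c₁ P ≡ c₄ P
    spine-ends d≢e i l₀ P = theta-ends d≢e P
      (apart i {0F} {0F} {0F} {2F} λ ()) (apart i {0F} {1F} {0F} {3F} λ ())
      (apart i {0F} {2F} {0F} {4F} λ ())
      (φ-trail d≢e i 1F l₀) (φ-trail d≢e i 2F l₀)
      (apart i {0F} {1F} {1F} {1F} λ ()) (apart i {0F} {1F} {2F} {1F} λ ())
      (apart i {1F} {1F} {2F} {1F} λ ())

    no-level : ∀ {d e} → d ≢ e → ¬ Level k d (φ (v 0F 0F 0F))
    no-level d≢e l₀ =
      let e≢d = ≢-sym d≢e
          l₁ , a  , t₁ = φ-edge d≢e 0F 0F 0F l₀
          l₂ , b  , t₂ = φ-edge e≢d 0F 0F 1F l₁
          l₃ , c  , t₃ = φ-edge d≢e 0F 0F 2F l₂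
          l₄ , a′ , t₄ = φ-edge e≢d 0F 0F 3F l₃
          l₅ , b′ , t₅ = φ-edge d≢e 1F 0F 3F l₄
          _  , c′ , t₆ = φ-edge e≢d 2F 0F 3F l₅
          a≡a′ = spine-ends d≢e 0F l₀ (record { t₁ = t₁ ; t₂ = t₂ ; t₃ = t₃ ; t₄ = t₄ })
          b≡b′ = spine-ends e≢d 1F l₁ (record { t₁ = t₂ ; t₂ = t₃ ; t₃ = t₄ ; t₄ = t₅ })
          c≡c′ = spine-ends d≢e 2F l₂ (record { t₁ = t₃ ; t₂ = t₄ ; t₃ = t₅ ; t₄ = t₆ })
          a≢b = distinct-colours d≢e t₁ t₂ (apart 0F {0F} {0F} {0F} {2F} λ ())
          b≢c = distinct-colours e≢d t₂ t₃ (apart 0F {0F} {1F} {0F} {3F} λ ())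
      in φ-separates {v 0F 0F 0F} {v 2F 0F 4F} (λ ())
           (period-3-closes a≢b b≢c (distinct-colours₂ d≢e a≢b t₁ t₂ t₃) t₁ t₂ t₃
             (subst (λ x → Toggle _ _ x _ _) (sym a≡a′) t₄)
             (subst (λ x → Toggle _ _ x _ _) (sym b≡b′) t₅)
             (subst (λ x → Toggle _ _ x _ _) (sym c≡c′) t₆))

  not-in-edgeLayer : ⊥
  not-in-edgeLayer with A∈ , _ ← edges⊆Adj S (Equivalence.to
      (adj⇔ (v 0F 0F 0F) (v 0F 0F 1F)) ((0F , 0F , 0F) , inj₁ refl)) =
    [ no-level {inside} {outside} (λ ()) , no-level {outside} {inside} (λ ()) ]′ A∈

G-not-layered : ¬ Layered G
G-not-layered (_ , _ , S , iso) = not-in-edgeLayer {S = S} iso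

-- G has girth 8

-- Search for closed walks without backtracking in a graph given by the list
-- of its directed edges.
module _ {V : Set} (_≟_ : DecidableEquality V) where

  private
    _≟ᴱ_ : DecidableEquality (V × V)
    _≟ᴱ_ = ×-≡-dec _≟_ _≟_

  -- Repetitions are removed because they would multiply the walks to follow.
  bothWays : List (V × V) → List (V × V)
  bothWays E = deduplicate _≟ᴱ_ (E ++ map swap E)

  ∈-bothWays : ∀ {E e} → e ∈ E → e ∈ bothWays E
  ∈-bothWays e∈E = ∈-deduplicate⁺ _≟ᴱ_ (∈-++⁺ˡ e∈E)

  swap-∈-bothWays : ∀ {E e} → e ∈ E → swap e ∈ bothWays E
  swap-∈-bothWays {E} e∈E = ∈-deduplicate⁺ _≟ᴱ_ (∈-++⁺ʳ E (∈-map⁺ swap e∈E))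

  -- No walk without backtracking that starts with the edge from p to c meets
  -- s within its first n vertices from c on.
  Misses : List (V × V) → V → ℕ → V × V → Set
  Misses E s zero    (p , c) = ⊤
  Misses E s (suc n) (p , c) =
    c ≢ s × All (λ e → proj₁ e ≡ c → proj₂ e ≢ p → Misses E s n e) E

  misses? : ∀ E s n e → Dec (Misses E s n e)
  misses? E s zero    e       = yes tt
  misses? E s (suc n) (p , c) = ¬? (c ≟ s) ×-dec
    All.all? (λ e → (proj₁ e ≟ c) →-dec ¬? (proj₂ e ≟ p) →-dec misses? E s n e) E

  -- No walk without backtracking is back at its start after 1, …, n steps.
  NoReturn : List (V × V) → ℕ → Set
  NoReturn E n = All (λ e → Misses E (proj₁ e) n e) E

  noReturn? : ∀ E n → Dec (NoReturn E n)
  noReturn? E n = All.all? (λ e → misses? E (proj₁ e) n e) E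

  module _ {E : List (V × V)} (w : ℕ → V)
           (walk : ∀ k → (w k , w (suc k)) ∈ E) (no-backtrack : ∀ k → w (2 + k) ≢ w k) where

    misses-walk : ∀ {s n} k → Misses E s n (w k , w (suc k)) →
                  ∀ {m} → m < n → w (suc (m + k)) ≢ s
    misses-walk {n = suc n} k (c≢s , _) {zero} _ = c≢s
    misses-walk {s} {suc n} k (_ , rest) {suc m} (s≤s m<n) =
      subst (λ x → w (suc x) ≢ s) (+-suc m k)
        (misses-walk (suc k) (All.lookup rest (walk (suc k)) refl (no-backtrack k)) m<n)

    no-return : ∀ {n} → NoReturn E n → ∀ {m} → m < n → w (suc m) ≢ w 0
    no-return none {m} m<n = subst (λ x → w (suc x) ≢ w 0) (+-identityʳ m)
      (misses-walk 0 (All.lookup none (walk 0)) m<n)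

-- The index reached after k steps round a cycle of length 1 + ℓ.
around : ∀ {ℓ} → ℕ → Fin (suc ℓ)
around zero    = zero
around (suc k) = cyclicSuc (around k)

-- In the next lemmas the cycles considered have length 3 + m with m < 5, that
-- is, between 3 and 7.

around-closes : ∀ (m : Fin 5) → around {2 + toℕ m} (3 + toℕ m) ≡ zero
around-closes = from-yes (all? {n = 5} λ m → around {2 + toℕ m} (3 + toℕ m) Fin.≟ zero {2 + toℕ m})

cyclicSuc²≢id : ∀ (m : Fin 5) (i : Fin (3 + toℕ m)) → cyclicSuc (cyclicSuc i) ≢ i
cyclicSuc²≢id = from-yes (all? {n = 5} λ m → all? λ i → ¬? (cyclicSuc {3 + toℕ m} (cyclicSuc {3 + toℕ m} i) Fin.≟ i))

_≟ˢ_ : ∀ {n} → DecidableEquality (Subset n)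
_≟ˢ_ = ≡-dec _≟ᴮ_

indices : List Index
indices = cartesianProduct (allFin 3) (cartesianProduct (allFin 3) (allFin 4))

upward : Index → Subset 6 × Subset 6
upward x = source x , target x

directedEdges : List (Subset 6 × Subset 6)
directedEdges = bothWays _≟ˢ_ (map upward indices)

∈-indices : ∀ x → x ∈ indices
∈-indices (i , r , j) =
  ∈-cartesianProduct⁺ (∈-allFin i) (∈-cartesianProduct⁺ (∈-allFin r) (∈-allFin j))

edge⇒∈ : ∀ {A B} → edges thetas A B → (A , B) ∈ directedEdges
edge⇒∈ (x , inj₁ refl) = ∈-bothWays _≟ˢ_ (∈-map⁺ upward (∈-indices x))
edge⇒∈ (x , inj₂ refl) = swap-∈-bothWays _≟ˢ_ (∈-map⁺ upward (∈-indices x))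

no-return-in-G : NoReturn _≟ˢ_ directedEdges 7
no-return-in-G = from-yes (noReturn? _≟ˢ_ directedEdges 7)

no-short-cycle : ∀ (m : Fin 5) → ¬ Cycle G (3 + toℕ m)
no-short-cycle m C = no-return _≟ˢ_ w
  (λ k → edge⇒∈ (adjacent (around k)))
  (λ k eq → cyclicSuc²≢id m (around k) (distinct (value-injective eq)))
  no-return-in-G (s≤s (s≤s (Fin.toℕ<n m)))
  (cong (value ∘ vertex) (around-closes m))
  where
  open Cycle C
  w : ℕ → Subset 6
  w k = value (vertex (around k))

girth≥8 : ∀ {ℓ} → Cycle G ℓ → 8 ≤ ℓ
girth≥8 {ℓ} C with ℓ ℕ.<? 8 | Cycle.3≤length C
... | no  ℓ≮8 | _ = ≮⇒≥ ℓ≮8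
... | yes (s≤s (s≤s (s≤s m<5))) | s≤s (s≤s (s≤s _)) =
  contradiction (subst (λ m → Cycle G (3 + m)) (sym (toℕ-fromℕ< m<5)) C)
                (no-short-cycle (fromℕ< m<5))

-- Two paths of the theta with i = 0.
octagon : Cycle G 8
octagon = record
  { 3≤length = s≤s (s≤s (s≤s z≤n))
  ; vertex   = corner
  ; distinct = λ {a} {b} eq → corner-injective a b (cong value eq)
  ; adjacent = λ
    { 0F → (0F , 0F , 0F) , inj₁ refl ; 1F → (0F , 0F , 1F) , inj₁ refl
    ; 2F → (0F , 0F , 2F) , inj₁ refl ; 3F → (0F , 0F , 3F) , inj₁ refl
    ; 4F → (0F , 1F , 3F) , inj₂ refl ; 5F → (0F , 1F , 2F) , inj₂ refl
    ; 6F → (0F , 1F , 1F) , inj₂ refl ; 7F → (0F , 1F , 0F) , inj₂ refl }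
  }
  where
  corner : Fin 8 → Vertex G
  corner = lookup
    ( v 0F 0F 0F ∷ v 0F 0F 1F ∷ v 0F 0F 2F ∷ v 0F 0F 3F
    ∷ v 0F 0F 4F ∷ v 0F 1F 3F ∷ v 0F 1F 2F ∷ v 0F 1F 1F ∷ [] )

  corner-injective : ∀ a b → value (corner a) ≡ value (corner b) → a ≡ b
  corner-injective = from-yes (all? λ a → all? λ b →
    (value (corner a) ≟ˢ value (corner b)) →-dec (a Fin.≟ b))

theorem3 : ∃ λ (G : Graph) → Cubical G × HasGirth G 8 × ¬ Layered G
theorem3 = G , G-cubical , (octagon , girth≥8) , G-not-layered
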